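{- The system of infinite-valued logic with axioms A1 $=i(x,i(y,x))$, A2 $=i(i(x,y),i(i(y,z),i(x,z)))$, A3 $=i(i(i(x,y),y),i(i(y,x),x))$, A4 $=i(i(n(x),n(y)),i(y,x))$ and condensed detachment as sole rule of inference admits strong double-negation elimination.
   Context: Formulas are terms built from propositional variables using the binary connective $i$ (implication) and the unary connective $n$ (negation). Condensed detachment: from a major premiss $i(A,B)$ and a minor premiss $C$, after renaming variables so that the two premisses share no variables, if $A$ and $C$ are unifiable with most general unifier $\sigma$, infer $B\sigma$. Alphabetic variants of axioms count as axioms, and conclusions may be renamed. A proof is a finite sequence of formulas each an axiom or obtained from earlier lines by the rule; deduced steps are the non-axiom lines. Given a formula $B$, a formula $B^*$ is obtained from $B$ by selecting some set of doubly negated subformulas $n(n(q))$ of $B$ and replacing all occurrences of each selected subformula by $q$. A system admits strong double-negation elimination if whenever it proves $B$ and $B^*$ is obtained from $B$ in this way, there is a proof of $B^*$ in the system in which every subformula of the form $n(n(t))$ of a deduced step occurs (up to renaming of variables) as a subformula of $B^*$. -}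

module Defs where

open import Data.Bool using (if_then_else_)
open import Data.Nat using (ℕ)
import Data.Nat.Properties as ℕ
open import Data.List using (List; []; _∷_)
open import Data.List.Membership.Propositional using (_∈_)
import Data.List.Membership.DecPropositional as DecMembership
open import Data.Product using (Σ-syntax; ∃-syntax; _×_)
open import Relation.Binary.PropositionalEquality using (_≡_; refl)
open import Relation.Binary.Definitions using (DecidableEquality)
open import Relation.Nullary using (¬_; does; yes; no)

data Formula : Set where
  var : ℕ → Formula
  i   : Formula → Formula → Formula
  n   : Formula → Formula

infix 4 _≟_

_≟_ : DecidableEquality Formula
var x ≟ var y with x ℕ.≟ y
... | yes refl = yes refl
... | no x≢y   = no λ { refl → x≢y refl }
var _ ≟ i _ _ = no λ ()
var _ ≟ n _   = no λ ()
i _ _ ≟ var _ = no λ ()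
i A B ≟ i C D with A ≟ C | B ≟ D
... | yes refl | yes refl = yes refl
... | no A≢C   | _        = no λ { refl → A≢C refl }
... | yes _    | no B≢D   = no λ { refl → B≢D refl }
i _ _ ≟ n _   = no λ ()
n _ ≟ var _   = no λ ()
n _ ≟ i _ _   = no λ ()
n A ≟ n B with A ≟ B
... | yes refl = yes refl
... | no A≢B   = no λ { refl → A≢B refl }

infix 4 _⊑_

data _⊑_ (s : Formula) : Formula → Set where
  here   : s ⊑ s
  left   : ∀ {A B} → s ⊑ A → s ⊑ i A B
  right  : ∀ {A B} → s ⊑ B → s ⊑ i A B
  under  : ∀ {A} → s ⊑ A → s ⊑ n A

OccursIn : ℕ → Formula → Set
OccursIn x A = var x ⊑ A

Subst : Set
Subst = ℕ → Formula

infixl 8 _[_]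

_[_] : Formula → Subst → Formula
var x [ σ ] = σ x
i A B [ σ ] = i (A [ σ ]) (B [ σ ])
n A   [ σ ] = n (A [ σ ])

Variant : Formula → Formula → Set
Variant A B = Σ[ ρ ∈ (ℕ → ℕ) ]
    (∀ x y → OccursIn x A → OccursIn y A → ρ x ≡ ρ y → x ≡ y)
  × B ≡ A [ (λ x → var (ρ x)) ]

Unifier : Subst → Formula → Formula → Set
Unifier σ A C = A [ σ ] ≡ C [ σ ]

MGU : Subst → Formula → Formula → Set
MGU σ A C = Unifier σ A C
  × (∀ τ → Unifier τ A C → ∃[ ρ ] (∀ x → τ x ≡ σ x [ ρ ]))

record CondensedDetachment (major minor conclusion : Formula) : Set where
  field
    {A B C}         : Formula
    σ               : Subst
    major-variant   : Variant major (i A B)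
    minor-variant   : Variant minor C
    apart           : ∀ x → OccursIn x (i A B) → ¬ OccursIn x C
    mgu             : MGU σ A C
    conclusion-variant : Variant (B [ σ ]) conclusion

System : Set
System = List Formula

IsAxiom : System → Formula → Set
IsAxiom L A = ∃[ α ] (α ∈ L × Variant α A)

-- The lines of a proof are listed with the most recent line first.
data IsProof (L : System) : List Formula → Set where
  []     : IsProof L []
  axiom  : ∀ {Γ A} → IsAxiom L A → IsProof L Γ → IsProof L (A ∷ Γ)
  detach : ∀ {Γ P M A} → P ∈ Γ → M ∈ Γ → CondensedDetachment P M A →
           IsProof L Γ → IsProof L (A ∷ Γ)

IsProofOf : System → List Formula → Formula → Set
IsProofOf L Π B = IsProof L Π × ∃[ Γ ] (Π ≡ B ∷ Γ)

Proves : System → Formula → Set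
Proves L B = ∃[ Π ] IsProofOf L Π B

DeducedStep : System → List Formula → Formula → Set
DeducedStep L Π A = A ∈ Π × ¬ IsAxiom L A

open DecMembership _≟_ using (_∈?_)

-- Replaces every occurrence of each n (n q) in S by q.  Where selected
-- occurrences overlap, the outermost one is replaced first and the
-- replacement continues inside its q.
erase : List Formula → Formula → Formula
erase S (var x) = var x
erase S (i A B) = i (erase S A) (erase S B)
erase S (n (n q)) =
  if does (n (n q) ∈? S) then erase S q else n (erase S (n q))
erase S (n (var x)) = n (var x)
erase S (n (i A B)) = n (i (erase S A) (erase S B))

Erasure : Formula → Formula → Set
Erasure B B* = ∃[ S ]
    (∀ s → s ∈ S → s ⊑ B × ∃[ q ] s ≡ n (n q))
  × B* ≡ erase S B

DoubleNegationsWithin : System → List Formula → Formula → Set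
DoubleNegationsWithin L Π B =
  ∀ A → DeducedStep L Π A → ∀ t → n (n t) ⊑ A →
  ∃[ s ] (s ⊑ B × Variant s (n (n t)))

AdmitsStrongDNE : System → Set
AdmitsStrongDNE L =
  ∀ B B* → Proves L B → Erasure B B* →
  ∃[ Π ] (IsProofOf L Π B* × DoubleNegationsWithin L Π B*)

private
  x y z : Formula
  x = var 0
  y = var 1
  z = var 2

A1 A2 A3 A4 : Formula
A1 = i x (i y x)
A2 = i (i x y) (i (i y z) (i x z))
A3 = i (i (i x y) y) (i (i y x) x)
A4 = i (i (n x) (n y)) (i y x)

InfiniteValued : System
InfiniteValued = A1 ∷ A2 ∷ A3 ∷ A4 ∷ []

{-# OPTIONS --safe #-}
-- A condensed detachment proof of B is, after substitution, a modus ponens proof from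
-- axiom instances.  Erasing double negations commutes with modus ponens and with
-- instances of A1–A3, and turns an instance of A4 into an instance of A4 or of one of
-- the contraposition laws i(i(x,y),i(n(y),n(x))), i(i(x,n(y)),i(y,n(x))),
-- i(i(n(x),y),i(n(y),x)), which have proofs free of double negations.  Erasing first the
-- selected double negations and then all those that do not occur in B*, we get a modus
-- ponens proof of B* in which only double negations of B* occur.
--
-- It remains to obtain any substitution instance of a theorem α by condensed detachment
-- without further double negations.  Detaching α from i(αθ,αθ) gives αθ, so it suffices
-- to derive i(P,P) for every P.  This is done by recursion on P; variables shared by two
-- subformulas are identified through i(x,i(x,x)), which follows from A3.
module Submission where

open import Data.Bool using (Bool; true; false; if_then_else_; not; T)
open import Data.Empty using (⊥; ⊥-elim)
open import Data.List using (List; []; _∷_; _++_; map; deduplicate; upTo)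
open import Data.List.Membership.Propositional using (_∈_)
open import Data.List.Membership.Propositional.Properties using (∈-++⁺ˡ; ∈-++⁺ʳ; ∈-deduplicate⁺; ∈-upTo⁺)
open import Data.List.Relation.Unary.All using (All; []; _∷_)
import Data.List.Relation.Unary.All as All
import Data.List.Relation.Unary.All.Properties as All
open import Data.List.Relation.Unary.Any using (here; there)
open import Data.Maybe using (Maybe; just; nothing; is-just)
import Data.Maybe as Maybe
open import Data.Nat using (ℕ; zero; suc; _+_; _∸_; _⊔_; _≤_; _<_; _<?_; z≤n; s≤s)
import Data.Nat.Properties as ℕ
open import Data.Product using (∃-syntax; _×_; _,_; proj₁; proj₂)
open import Data.Sum using (_⊎_; inj₁; inj₂)
open import Data.Unit using (⊤; tt)
open import Function using (_∘_; case_of_)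
open import Relation.Binary.PropositionalEquality using (_≡_; refl; sym; trans; cong; cong₂; subst; module ≡-Reasoning)
open import Relation.Nullary using (¬_; Dec; yes; no; does)

open import Defs
open import Data.List.Membership.DecPropositional _≟_ using (_∈?_)

-- Substitutions

i-injective : ∀ {A B C D} → i A B ≡ i C D → A ≡ C × B ≡ D
i-injective refl = refl , refl

n-injective : ∀ {A B} → n A ≡ n B → A ≡ B
n-injective refl = refl

⊑-trans : ∀ {A B C} → A ⊑ B → B ⊑ C → A ⊑ C
⊑-trans p here = p
⊑-trans p (left q)  = left (⊑-trans p q)
⊑-trans p (right q) = right (⊑-trans p q)
⊑-trans p (under q) = under (⊑-trans p q)

_⊑?_ : ∀ s A → Dec (s ⊑ A)
s ⊑? A with s ≟ A
s ⊑? A     | yes refl = yes here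
s ⊑? var x | no s≢A = no λ { here → s≢A refl }
s ⊑? n A   | no s≢A with s ⊑? A
... | yes p = yes (under p)
... | no ¬p = no λ { here → s≢A refl ; (under p) → ¬p p }
s ⊑? i A B | no s≢A with s ⊑? A | s ⊑? B
... | yes p | _     = yes (left p)
... | no _  | yes q = yes (right q)
... | no ¬p | no ¬q = no λ { here → s≢A refl ; (left p) → ¬p p ; (right q) → ¬q q }

[]-cong : ∀ A {σ τ} → (∀ x → OccursIn x A → σ x ≡ τ x) → A [ σ ] ≡ A [ τ ]
[]-cong (var x) eq = eq x here
[]-cong (i A B) eq = cong₂ i ([]-cong A λ x p → eq x (left p)) ([]-cong B λ x p → eq x (right p))
[]-cong (n A)   eq = cong n ([]-cong A λ x p → eq x (under p))

[]-agree : ∀ A {σ τ} → A [ σ ] ≡ A [ τ ] → ∀ x → OccursIn x A → σ x ≡ τ x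
[]-agree (var x) eq .x here = eq
[]-agree (i A B) eq x (left p)  = []-agree A (proj₁ (i-injective eq)) x p
[]-agree (i A B) eq x (right p) = []-agree B (proj₂ (i-injective eq)) x p
[]-agree (n A)   eq x (under p) = []-agree A (n-injective eq) x p

[]-id : ∀ A → A [ var ] ≡ A
[]-id (var x) = refl
[]-id (i A B) = cong₂ i ([]-id A) ([]-id B)
[]-id (n A)   = cong n ([]-id A)

[]-comp : ∀ A {σ τ} → A [ σ ] [ τ ] ≡ A [ (λ x → σ x [ τ ]) ]
[]-comp (var x) = refl
[]-comp (i A B) = cong₂ i ([]-comp A) ([]-comp B)
[]-comp (n A)   = cong n ([]-comp A)

occurs-[] : ∀ {A σ x y} → OccursIn x A → OccursIn y (σ x) → OccursIn y (A [ σ ])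
occurs-[] here q = q
occurs-[] (left p)  q = left (occurs-[] p q)
occurs-[] (right p) q = right (occurs-[] p q)
occurs-[] (under p) q = under (occurs-[] p q)

Variant-refl : ∀ {A} → Variant A A
Variant-refl {A} = (λ x → x) , (λ _ _ _ _ eq → eq) , sym ([]-id A)

bound : Formula → ℕ
bound (var x) = suc x
bound (i A B) = bound A ⊔ bound B
bound (n A)   = bound A

Below : ℕ → Formula → Set
Below m A = ∀ x → OccursIn x A → x < m

below-bound : ∀ A → Below (bound A) A
below-bound (var x) .x here = ℕ.≤-refl
below-bound (i A B) x (left p)  = ℕ.≤-trans (below-bound A x p) (ℕ.m≤m⊔n (bound A) (bound B))
below-bound (i A B) x (right p) = ℕ.≤-trans (below-bound B x p) (ℕ.m≤n⊔m (bound A) (bound B))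
below-bound (n A)   x (under p) = below-bound A x p

-- Once the variables of the minor premiss are shifted by `m`, this makes one substitution out of
-- one for each premiss. Elsewhere it alters a substitution from `m` on.
join : ℕ → Subst → Subst → Subst
join m σ π x with x <? m
... | yes _ = σ x
... | no _  = π (x ∸ m)

join-< : ∀ {m σ π x} → x < m → join m σ π x ≡ σ x
join-< {m} {x = x} x<m with x <? m
... | yes _  = refl
... | no x≮m = ⊥-elim (x≮m x<m)

join-+ : ∀ m {σ π} x → join m σ π (x + m) ≡ π x
join-+ m {π = π} x with (x + m) <? m
... | yes x+m<m = ⊥-elim (ℕ.<⇒≱ x+m<m (ℕ.m≤n+m m x))
... | no _      = cong π (ℕ.m+n∸n≡m x m)

[]-join : ∀ {m σ π} A → Below m A → A [ join m σ π ] ≡ A [ σ ]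
[]-join A A<m = []-cong A λ x p → join-< (A<m x p)

-- Condensed detachment from a most general pair of matching substitutions

shift : ℕ → Formula → Formula
shift m A = A [ (λ x → var (x + m)) ]

shift-variant : ∀ m A → Variant A (shift m A)
shift-variant m A = (_+ m) , (λ x y _ _ → ℕ.+-cancelʳ-≡ m x y) , refl

shift-occurs : ∀ m A x → OccursIn x (shift m A) → m ≤ x
shift-occurs m (var y) .(y + m) here = ℕ.m≤n+m m y
shift-occurs m (i A B) x (left p)  = shift-occurs m A x p
shift-occurs m (i A B) x (right p) = shift-occurs m B x p
shift-occurs m (n A)   x (under p) = shift-occurs m A x p

condensedDetachment : ∀ {A D C E} σ → MGU σ A (shift (bound (i A D)) C) →
  Variant (D [ σ ]) E → CondensedDetachment (i A D) C E
condensedDetachment {A} {D} {C} σ mgu variant = record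
  { σ = σ
  ; major-variant = Variant-refl
  ; minor-variant = shift-variant _ C
  ; apart = λ x p q → ℕ.<⇒≱ (below-bound (i A D) x p) (shift-occurs _ C x q)
  ; mgu = mgu
  ; conclusion-variant = variant
  }

-- Stated for premisses not yet renamed apart, with a substitution for each. Only the values on the
-- two premisses have to factor; `D` is included because it may have variables that `A` lacks.
MostGeneral : Formula → Formula → Formula → Subst → Subst → Set
MostGeneral A D C σ₁ σ₂ = ∀ τ₁ τ₂ → A [ τ₁ ] ≡ C [ τ₂ ] →
  ∃[ ρ ] (i A D [ τ₁ ] ≡ i A D [ σ₁ ] [ ρ ] × C [ τ₂ ] ≡ C [ σ₂ ] [ ρ ])

-- An MGU must factor every unifier on all variables, so the variables that do not
-- occur in the premisses are sent to distinct variables unused by σ₁ and σ₂.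
detach-match : ∀ {A D C E} σ₁ σ₂ → A [ σ₁ ] ≡ C [ σ₂ ] → MostGeneral A D C σ₁ σ₂ →
  E ≡ D [ σ₁ ] → CondensedDetachment (i A D) C E
detach-match {A} {D} {C} {E} σ₁ σ₂ unifies general refl =
  condensedDetachment σ (unifier , factor)
    (subst (λ X → Variant X E) (sym ([]-cong D λ x p → trans (σ-on x (left (right p)))
      (join-< (below-bound (i A D) x (right p))))) Variant-refl)
  where
  m : ℕ
  m = bound (i A D)
  C′ F : Formula
  C′ = shift m C
  F = i (i A D) C′
  σ̂ : Subst
  σ̂ = join m σ₁ σ₂
  k : ℕ
  k = bound (F [ σ̂ ])
  σ : Subst
  σ x = if does (var x ⊑? F) then σ̂ x else var (x + k)

  σ-on : ∀ x → OccursIn x F → σ x ≡ σ̂ x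
  σ-on x p with var x ⊑? F
  ... | yes _ = refl
  ... | no ¬p = ⊥-elim (¬p p)

  C′-[] : ∀ τ → C′ [ τ ] ≡ C [ (λ x → τ (x + m)) ]
  C′-[] τ = []-comp C

  AD-σ̂ : i A D [ σ̂ ] ≡ i A D [ σ₁ ]
  AD-σ̂ = []-join (i A D) (below-bound (i A D))

  C′-σ̂ : C′ [ σ̂ ] ≡ C [ σ₂ ]
  C′-σ̂ = trans (C′-[] σ̂) ([]-cong C λ x _ → join-+ m x)

  unifier : A [ σ ] ≡ C′ [ σ ]
  unifier = begin
    A [ σ ]   ≡⟨ []-cong A (λ x p → σ-on x (left (left p))) ⟩
    A [ σ̂ ]   ≡⟨ proj₁ (i-injective AD-σ̂) ⟩
    A [ σ₁ ]  ≡⟨ unifies ⟩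
    C [ σ₂ ]  ≡⟨ C′-σ̂ ⟨
    C′ [ σ̂ ]  ≡⟨ []-cong C′ (λ x p → σ-on x (right p)) ⟨
    C′ [ σ ]  ∎
    where open ≡-Reasoning

  factor : ∀ τ → A [ τ ] ≡ C′ [ τ ] → ∃[ ρ ] (∀ x → τ x ≡ σ x [ ρ ])
  factor τ eq with general τ (λ x → τ (x + m)) (trans eq (C′-[] τ))
  -- The images of the variables of `F` lie below `k`, where the join acts as `ρ`; any other `x`
  -- goes to `var (x + k)`, which the join sends to `τ x`.
  ... | ρ , eqAD , eqC = join k ρ τ , pointwise
    where
    F-eq : F [ τ ] ≡ F [ (λ x → σ̂ x [ ρ ]) ]
    F-eq = trans (cong₂ i (trans eqAD (cong (_[ ρ ]) (sym AD-σ̂)))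
                         (trans (C′-[] τ) (trans eqC (cong (_[ ρ ]) (sym C′-σ̂)))))
                 ([]-comp F)
    pointwise : ∀ x → τ x ≡ σ x [ join k ρ τ ]
    pointwise x with var x ⊑? F
    ... | yes p = trans ([]-agree F F-eq x p)
                    (sym ([]-join (σ̂ x) λ y q → below-bound (F [ σ̂ ]) y (occurs-[] p q)))
    ... | no _ = sym (join-+ k x)

-- Unification

Equations : Set
Equations = List (Formula × Formula)

Solves : Subst → Formula × Formula → Set
Solves τ (s , t) = Unifier τ s t

MGUs : Subst → Equations → Set
MGUs σ E = All (Solves σ) E × (∀ τ → All (Solves τ) E → ∃[ ρ ] (∀ x → τ x ≡ σ x [ ρ ]))

_↦_ : ℕ → Formula → Subst
(x ↦ t) y with y ℕ.≟ x
... | yes _ = t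
... | no _  = var y

↦-self : ∀ x t → (x ↦ t) x ≡ t
↦-self x t with x ℕ.≟ x
... | yes _  = refl
... | no x≢x = ⊥-elim (x≢x refl)

↦-absent : ∀ {x t} A → ¬ OccursIn x A → A [ x ↦ t ] ≡ A
↦-absent {x} {t} A x∉A = trans ([]-cong A other) ([]-id A)
  where
  other : ∀ y → OccursIn y A → (x ↦ t) y ≡ var y
  other y p with y ℕ.≟ x
  ... | yes refl = ⊥-elim (x∉A p)
  ... | no _     = refl

↦-factor : ∀ {x t τ} → τ x ≡ t [ τ ] → ∀ y → τ y ≡ (x ↦ t) y [ τ ]
↦-factor {x} eq y with y ℕ.≟ x
... | yes refl = eq
... | no _     = refl

-- A solution `τ` of the first equation is unchanged by applying `x ↦ t` before it, so it solves the
-- substituted equations and factors through `σ`.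
solve-var : ∀ {x t E σ} → ¬ OccursIn x t →
  MGUs σ (map (λ (s , u) → s [ x ↦ t ] , u [ x ↦ t ]) E) →
  MGUs (λ y → (x ↦ t) y [ σ ]) ((var x , t) ∷ E)
solve-var {x} {t} {E} {σ} x∉t (solves , general) =
    (trans (cong (_[ σ ]) (trans (↦-self x t) (sym (↦-absent t x∉t)))) ([]-comp t)
      ∷ All.map (λ {(s , u)} eq → trans (sym ([]-comp s)) (trans eq ([]-comp u))) (All.map⁻ solves))
  , factor
  where
  factor : ∀ τ → All (Solves τ) ((var x , t) ∷ E) →
           ∃[ ρ ] (∀ y → τ y ≡ (x ↦ t) y [ σ ] [ ρ ])
  factor τ (eq ∷ eqs) = proj₁ rec , λ y → begin
      τ y                            ≡⟨ through y ⟩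
      (x ↦ t) y [ τ ]                ≡⟨ []-cong ((x ↦ t) y) (λ z _ → proj₂ rec z) ⟩
      (x ↦ t) y [ (λ z → σ z [ proj₁ rec ]) ] ≡⟨ []-comp ((x ↦ t) y) ⟨
      (x ↦ t) y [ σ ] [ proj₁ rec ]  ∎
    where
    open ≡-Reasoning
    through : ∀ y → τ y ≡ (x ↦ t) y [ τ ]
    through = ↦-factor eq
    absorb : ∀ s → s [ x ↦ t ] [ τ ] ≡ s [ τ ]
    absorb s = trans ([]-comp s) (sym ([]-cong s λ y _ → through y))
    rec : ∃[ ρ ] (∀ y → τ y ≡ σ y [ ρ ])
    rec = general τ (All.map⁺ (All.map (λ {(s , u)} eq′ → trans (absorb s) (trans eq′ (sym (absorb u)))) eqs))

-- The first argument bounds the number of unification steps.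
unify : ℕ → (E : Equations) → Maybe (∃[ σ ] MGUs σ E)
unify _ [] = just (var , [] , λ τ _ → τ , λ _ → refl)
unify zero (_ ∷ _) = nothing
unify (suc f) ((var x , t) ∷ E) with var x ≟ t | var x ⊑? t
... | yes refl | _ = Maybe.map
      (λ (σ , eqs , general) → σ , refl ∷ eqs , λ { τ (_ ∷ eqs′) → general τ eqs′ }) (unify f E)
-- `nothing` carries no proof that unification fails; only successful runs are used.
... | no _ | yes _ = nothing
... | no _ | no x∉t = Maybe.map (λ (σ , mgus) → _ , solve-var x∉t mgus) (unify f _)
unify (suc f) ((s , var x) ∷ E) = Maybe.map
  (λ { (σ , eq ∷ eqs , general) →
       σ , sym eq ∷ eqs , λ { τ (eq′ ∷ eqs′) → general τ (sym eq′ ∷ eqs′) } })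
  (unify f ((var x , s) ∷ E))
unify (suc f) ((i A B , i C D) ∷ E) = Maybe.map
  (λ { (σ , eq₁ ∷ eq₂ ∷ eqs , general) →
       σ , cong₂ i eq₁ eq₂ ∷ eqs ,
       λ { τ (eq ∷ eqs′) →
           general τ (proj₁ (i-injective eq) ∷ proj₂ (i-injective eq) ∷ eqs′) } })
  (unify f ((A , C) ∷ (B , D) ∷ E))
unify (suc f) ((n A , n B) ∷ E) = Maybe.map
  (λ { (σ , eq ∷ eqs , general) →
       σ , cong n eq ∷ eqs , λ { τ (eq′ ∷ eqs′) → general τ (n-injective eq′ ∷ eqs′) } })
  (unify f ((A , B) ∷ E))
unify (suc f) ((i _ _ , n _) ∷ E) = nothing
unify (suc f) ((n _ , i _ _) ∷ E) = nothing

-- Condensed detachment by computation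

variables : Formula → List ℕ
variables (var x) = x ∷ []
variables (i A B) = variables A ++ variables B
variables (n A)   = variables A

∈-variables : ∀ {x} A → OccursIn x A → x ∈ variables A
∈-variables (var x) here      = here refl
∈-variables (i A B) (left p)  = ∈-++⁺ˡ (∈-variables A p)
∈-variables (i A B) (right p) = ∈-++⁺ʳ (variables A) (∈-variables B p)
∈-variables (n A)   (under p) = ∈-variables A p

indexIn : List ℕ → ℕ → ℕ
indexIn []       x = 0
indexIn (y ∷ ys) x with x ℕ.≟ y
... | yes _ = 0
... | no _  = suc (indexIn ys x)

indexIn-injective : ∀ {ys x x′} → x ∈ ys → x′ ∈ ys → indexIn ys x ≡ indexIn ys x′ → x ≡ x′
indexIn-injective {y ∷ ys} {x} {x′} p q eq with x ℕ.≟ y | x′ ℕ.≟ y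
... | yes refl | yes refl = refl
indexIn-injective (here x≡y) _ eq | no x≢y | no _ = ⊥-elim (x≢y x≡y)
indexIn-injective (there _) (here x′≡y) eq | no _ | no x′≢y = ⊥-elim (x′≢y x′≡y)
indexIn-injective (there p) (there q) eq | no _ | no _ =
  indexIn-injective p q (ℕ.suc-injective eq)

-- Renames the variables to 0, 1, 2, … in order of first occurrence.
normalise : ∀ A → ∃[ A′ ] Variant A A′
normalise A = _ , indexIn xs , (λ x y p q → indexIn-injective (member p) (member q)) , refl
  where
  xs : List ℕ
  xs = deduplicate ℕ._≟_ (variables A)
  member : ∀ {x} → OccursIn x A → x ∈ xs
  member p = ∈-deduplicate⁺ ℕ._≟_ (∈-variables A p)

condense : ∀ P M → Maybe (∃[ A ] CondensedDetachment P M A)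
condense (var _) M = nothing
condense (n _)   M = nothing
condense (i A B) M = Maybe.map
  (λ { (σ , eq ∷ [] , general) →
       let A′ , variant = normalise (B [ σ ]) in
       A′ , condensedDetachment σ (eq , λ τ eq′ → general τ (eq′ ∷ [])) variant })
  -- 500 steps suffice for every detachment written with `_∙_` below.
  (unify 500 ((A , shift (bound (i A B)) M) ∷ []))

-- `_∙_` requires `condense` to succeed, so its results never come from the default `var 0`.
conclusion : Formula → Formula → Formula
conclusion P M = Maybe.maybe proj₁ (var 0) (condense P M)

-- Derivations

-- K t means that the double negation n (n t) is allowed.
Within : (Formula → Set) → Formula → Set
Within K (var x)     = ⊤
Within K (i A B)     = Within K A × Within K B
Within K (n (var x)) = ⊤
Within K (n (i A B)) = Within K A × Within K B
Within K (n (n t))   = K t × Within K (n t)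

-- Derivations are trees here and become lists of lines at the end. Axioms carry no `Within`
-- condition because only deduced steps are restricted.
data Derivable (K : Formula → Set) : Formula → Set where
  axiom  : ∀ {A} → IsAxiom InfiniteValued A → Derivable K A
  detach : ∀ {P M A} → Derivable K P → Derivable K M → CondensedDetachment P M A →
           Within K A → Derivable K A

Closed : Formula → Set
Closed = Derivable (λ _ → ⊥)

infixl 9 _∙_

-- For concrete premisses both implicit conditions compute to products of unit types, so they are
-- filled in automatically.
_∙_ : ∀ {P M} → Closed P → Closed M →
      {T (is-just (condense P M))} → {Within (λ _ → ⊥) (conclusion P M)} →
      Closed (conclusion P M)
_∙_ {P} {M} p q {valid} {within} with condense P M
... | just (A , cd) = detach p q cd within

a1 : Closed A1
a1 = axiom (A1 , here refl , Variant-refl)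

a2 : Closed A2
a2 = axiom (A2 , there (here refl) , Variant-refl)

a3 : Closed A3
a3 = axiom (A3 , there (there (here refl)) , Variant-refl)

a4 : Closed A4
a4 = axiom (A4 , there (there (there (here refl))) , Variant-refl)

-- Theorems without double negations

x₀ x₁ x₂ x₃ x₄ x₅ x₆ x₇ : Formula
x₀ = var 0
x₁ = var 1
x₂ = var 2
x₃ = var 3
x₄ = var 4
x₅ = var 5
x₆ = var 6
x₇ = var 7

-- `a2 ∙ p ∙ q` chains the implications `p` and `q`. Here A1 supplies the antecedent of A3.
assertion : Closed (i x₀ (i (i x₀ x₁) x₁))
assertion = a2 ∙ a1 ∙ a3

-- A2 takes `i x₀ (i x₁ x₂)` to `i (i (i x₁ x₂) x₂) (i x₀ x₂)`; by `assertion`, `x₁` may replace the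
-- antecedent of the latter.
exchange : Closed (i (i x₀ (i x₁ x₂)) (i x₁ (i x₀ x₂)))
exchange = a2 ∙ a2 ∙ (a2 ∙ assertion)

prefixing : Closed (i (i x₀ x₁) (i (i x₂ x₀) (i x₂ x₁)))
prefixing = exchange ∙ a2

identity : Closed (i x₀ x₀)
identity = exchange ∙ a1 ∙ a1

-- Detaching two theorems from this formula yields their most general common instance.
diagonal : Closed (i x₀ (i x₀ x₀))
diagonal = prefixing ∙ (a2 ∙ a1) ∙ (prefixing ∙ a3 ∙ assertion)

exchange-diagonal : Closed (i (i x₀ (i x₀ x₁)) (i x₀ (i x₀ x₁)))
exchange-diagonal = diagonal ∙ exchange ∙ identity

-- This is `pair 0 (var 0)`, defined below. Discharging `identity` twice leaves two unrelated
-- variables, which `exchange-diagonal` identifies.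
pair-base : Closed (i (i (i x₀ x₀) (i (i x₀ x₀) x₁)) x₁)
pair-base = a2 ∙ exchange-diagonal ∙ (a2 ∙ (assertion ∙ identity) ∙ (assertion ∙ identity))

-- Adds a variable to the context of a pair and keeps the paired formula: by A1, `x₀` implies
-- `i x₄ x₀`.
pair-weaken : Closed (i (i (i x₀ (i x₁ x₂)) x₃) (i (i (i x₄ x₀) (i x₁ x₂)) x₃))
pair-weaken = a2 ∙ (a2 ∙ (prefixing ∙ (a2 ∙ identity))) ∙ (a2 ∙ (a2 ∙ a1))

pair-new : Closed (i x₀ (i (i (i x₁ x₀) (i (i x₁ x₁) x₂)) x₂))
pair-new = a2 ∙ (a2 ∙ (a2 ∙ a1 ∙ prefixing) ∙ a2) ∙ (prefixing ∙ pair-base)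

-- Adds `x₄` to the context and makes it the paired formula. By `pair-new` the new antecedent yields
-- `i x₀ x₂`, which A1 weakens to `i x₀ (i x₁ x₂)`.
pair-extend : Closed (i (i (i x₀ (i x₁ x₂)) x₃) (i (i (i x₄ x₀) (i (i x₄ x₄) x₂)) x₃))
pair-extend = a2 ∙ (a2 ∙ (exchange ∙ pair-new) ∙ (prefixing ∙ a1))

bifunctor : Closed (i (i x₀ x₁) (i (i x₂ x₃) (i (i x₁ x₂) (i x₀ x₃))))
bifunctor = a2 ∙ (a2 ∙ a2 ∙ prefixing) ∙ (a2 ∙ prefixing)

-- Chaining `diagonal` with A2 gives `i x₀ (i (i x₀ z) (i x₀ z))`, which ties one more copy of the
-- context to the others; `bifunctor` acts inside.
pair-arguments : Closed (i x₀ (i (i x₁ x₂)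
  (i (i x₀ (i (i (i x₂ x₃) (i x₁ x₄)) x₅)) (i x₀ (i (i x₃ x₄) x₅)))))
pair-arguments =
  a2 ∙ (a2 ∙ diagonal ∙ a2) ∙
    (a2 ∙ prefixing ∙ (a2 ∙ (a2 ∙ bifunctor ∙ (a2 ∙ a2 ∙ prefixing))))

-- `x₄` is the result of the first pair and the inner goal of the second, so the pairs are
-- discharged one inside the other, over a common context `x₀`.
pair-implication : Closed
  (i (i (i x₀ (i (i x₁ x₂) x₃)) x₄)
     (i (i (i x₀ (i (i x₅ x₆) x₄)) x₇)
        (i (i x₀ (i (i (i x₆ x₁) (i x₅ x₂)) x₃)) x₇)))
pair-implication =
  a2 ∙ (a2 ∙ prefixing ∙ prefixing) ∙
    (a2 ∙ (a2 ∙ (exchange ∙ (a2 ∙ pair-arguments ∙ exchange))) ∙ a2)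

-- Detaching a pair of `A` from this forces its result variable to become `i A A`, which is then the
-- conclusion.
pair-second : Closed (i (i (i x₀ (i x₁ x₁)) x₂) x₂)
pair-second = assertion ∙ (a1 ∙ identity)

ex-falso : Closed (i (n x₀) (i x₀ x₁))
ex-falso = a2 ∙ a1 ∙ a4

by-refutation : Closed (i (i (n x₀) (n (i x₁ x₁))) x₀)
by-refutation = exchange ∙ a4 ∙ identity

from-⊥ : Closed (i (n (i x₀ x₀)) x₁)
from-⊥ = exchange ∙ ex-falso ∙ identity

-- With f = n (i y y): x → f gives (n x → f) → f by by-refutation, and A3 turns this
-- into (f → n x) → n x.
to-negation : Closed (i (i x₀ (n (i x₁ x₁))) (n x₀))
to-negation = a2 ∙ (a2 ∙ by-refutation) ∙ (a2 ∙ a3 ∙ (assertion ∙ from-⊥))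

-- With f as above, `ex-falso` turns `n x₁` into x₁ → f, A2 gives x₀ → f, and `to-negation` gives
-- `n x₀`. The next two laws vary the two ends of this chain.
contraposition : Closed (i (i x₀ x₁) (i (n x₁) (n x₀)))
contraposition = a2 ∙ a2 ∙ (a2 ∙ (prefixing ∙ to-negation) ∙ (a2 ∙ ex-falso))

contraposition-n-right : Closed (i (i x₀ (n x₁)) (i x₁ (n x₀)))
contraposition-n-right =
  a2 ∙ a2 ∙ (a2 ∙ (prefixing ∙ to-negation) ∙ (a2 ∙ (exchange ∙ ex-falso)))

contraposition-n-left : Closed (i (i (n x₀) x₁) (i (n x₁) x₀))
contraposition-n-left = a2 ∙ a2 ∙ (a2 ∙ (prefixing ∙ by-refutation) ∙ (a2 ∙ ex-falso))

pair-negation : Closed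
  (i (i (i x₀ (i (i x₁ x₂) x₃)) x₄) (i (i x₀ (i (i (n x₂) (n x₁)) x₃)) x₄))
pair-negation = a2 ∙ (prefixing ∙ (a2 ∙ contraposition))

-- Derivations of i P P for arbitrary P

within-n : ∀ {K} A → Within K (n A) → Within K A
within-n (var x) _ = tt
within-n (i A B) w = w
within-n (n A)   w = proj₂ w

within-⊑ : ∀ {K t} A → Within K A → n (n t) ⊑ A → K t
within-⊑ (i A B)     (w , _) (left p)          = within-⊑ A w p
within-⊑ (i A B)     (_ , w) (right p)         = within-⊑ B w p
within-⊑ (n (i A B)) w       (under p)         = within-⊑ (i A B) w p
within-⊑ (n (n A))   (k , _) here              = k
within-⊑ (n (n A))   (_ , w) (under p)         = within-⊑ (n A) w p

within-map : ∀ {K L} → (∀ t → K t → L t) → ∀ A → Within K A → Within L A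
within-map f (var x)     _       = tt
within-map f (i A B)     (v , w) = within-map f A v , within-map f B w
within-map f (n (var x)) _       = tt
within-map f (n (i A B)) (v , w) = within-map f A v , within-map f B w
within-map f (n (n A))   (k , w) = f A k , within-map f (n A) w

fromClosed : ∀ {K A} → Closed A → Derivable K A
fromClosed (axiom a)          = axiom a
fromClosed (detach p q cd w)  = detach (fromClosed p) (fromClosed q) cd (within-map (λ _ ()) _ w)

-- Each context is itself a theorem, as it must be for the pairs over it to be derivable.
context : ℕ → Formula
context zero    = i x₀ x₀
context (suc k) = i (var (suc k)) (context k)

-- i A A paired, in the style of Church, with a context that mentions the variables
-- 0, …, k: unifying the contexts of two pairs identifies their variables again after
-- the premisses of a detachment were renamed apart.
pair : ℕ → Formula → Formula
pair k A = i (i (context k) (i (i A A) (var (suc k)))) (var (suc k))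

context-below : ∀ k → Below (suc k) (context k)
context-below zero    x (left here)  = s≤s z≤n
context-below zero    x (right here) = s≤s z≤n
context-below (suc k) x (left here)  = ℕ.≤-refl
context-below (suc k) x (right p)    = ℕ.m≤n⇒m≤1+n (context-below k x p)

occurs-context : ∀ {k x} → x < suc k → OccursIn x (context k)
occurs-context {zero}  (s≤s z≤n) = left here
occurs-context {suc k} x<2+k with ℕ.m≤n⇒m<n∨m≡n x<2+k
... | inj₁ (s≤s x<1+k) = right (occurs-context x<1+k)
... | inj₂ refl        = left here

context-within : ∀ {K} k → Within K (context k)
context-within zero    = tt , tt
context-within (suc k) = tt , context-within k

below-weaken : ∀ {m A} → Below m A → Below (suc m) A
below-weaken A<m x p = ℕ.m≤n⇒m≤1+n (A<m x p)

[]-factor : ∀ {m} D τ σ ρ → Below m D → All (λ x → τ x ≡ σ x [ ρ ]) (upTo m) →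
  D [ τ ] ≡ D [ σ ] [ ρ ]
[]-factor D τ σ ρ D<m eqs =
  trans ([]-cong D λ x p → All.lookup eqs (∈-upTo⁺ (D<m x p))) (sym ([]-comp D))

-- The unifier for `pair-weaken` and `pair-extend`: `var (1 + k)` becomes the new context variable,
-- so the result variable moves up to `var (2 + k)`.
extension : ℕ → Formula → Subst
extension k A 0 = context k
extension k A 1 = i A A
extension k A 2 = var (2 + k)
extension k A 3 = var (2 + k)
extension k A _ = var (1 + k)

pair-injective : ∀ {A B C D A′ B′ C′ D′} →
  i (i A (i B C)) D ≡ i (i A′ (i B′ C′)) D′ → A ≡ A′ × B ≡ B′ × C ≡ C′ × D ≡ D′
pair-injective refl = refl , refl , refl , refl

pair-step : ∀ {K} k {A} D → Below (suc k) A →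
  Below 5 (i (i (i x₀ (i x₁ x₂)) x₃) D) → Closed (i (i (i x₀ (i x₁ x₂)) x₃) D) →
  Derivable K (pair k A) → Within K (D [ extension k A ]) →
  Derivable K (D [ extension k A ])
pair-step k {A} D A<m major<5 major minor w =
  detach (fromClosed major) minor
    (detach-match (extension k A) σ₂ (sym minor-σ₂) general refl) w
  where
  m : ℕ
  m = suc k
  σ₂ : Subst
  σ₂ = join m var (λ _ → var (suc m))

  minor-σ₂ : pair k A [ σ₂ ] ≡ i (i (context k) (i (i A A) (var (suc m)))) (var (suc m))
  minor-σ₂
    rewrite []-join {m} {var} {λ _ → var (suc m)} (context k) (context-below k)
          | []-join {m} {var} {λ _ → var (suc m)} A A<m
          | join-+ m {var} {λ _ → var (suc m)} 0
          | []-id (context k) | []-id A = refl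

  general : MostGeneral (i (i x₀ (i x₁ x₂)) x₃) D (pair k A) (extension k A) σ₂
  general τ₁ τ₂ eq with pair-injective eq
  ... | eq₀ , eq₁ , eq₂ , eq₃ = ρ ,
      []-factor (i (i (i x₀ (i x₁ x₂)) x₃) D) τ₁ (extension k A) ρ major<5
        (trans eq₀ (sym ctx-ρ) ∷ trans eq₁ (cong₂ i (sym A-ρ) (sym A-ρ)) ∷
         trans eq₂ (sym z-ρ) ∷ trans eq₃ (sym z-ρ) ∷ sym (join-+ m 0) ∷ [])
    , sym (trans (cong (_[ ρ ]) minor-σ₂)
        (cong₂ i (cong₂ i ctx-ρ (cong₂ i (cong₂ i A-ρ A-ρ) z-ρ)) z-ρ))
    where
    π ρ : Subst
    -- `var m` is the image of `x₄`, and `var (suc m)` stands for the old result variable `var m` of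
    -- the minor premiss.
    π 0 = τ₁ 4
    π _ = τ₂ m
    ρ = join m τ₂ π
    ctx-ρ : context k [ ρ ] ≡ context k [ τ₂ ]
    ctx-ρ = []-join (context k) (context-below k)
    A-ρ : A [ ρ ] ≡ A [ τ₂ ]
    A-ρ = []-join A A<m
    z-ρ : ρ (suc m) ≡ τ₂ m
    z-ρ = join-+ m 1

pair-var : ∀ {K} k x → x ≤ k → Derivable K (pair k (var x))
pair-var zero    .0 z≤n = fromClosed pair-base
pair-var (suc k) x x≤1+k with ℕ.m≤n⇒m<n∨m≡n x≤1+k
... | inj₁ (s≤s x≤k) =
  pair-step k (i (i (i x₄ x₀) (i x₁ x₂)) x₃) (λ { .x here → s≤s x≤k }) (below-bound _) pair-weaken
    (pair-var k x x≤k) (((tt , context-within k) , (tt , tt) , tt) , tt)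
-- Here `x` is the new context variable; only the context of the smaller pair is kept.
... | inj₂ refl =
  pair-step k (i (i (i x₄ x₀) (i (i x₄ x₄) x₂)) x₃) (λ { .k here → ℕ.≤-refl }) (below-bound _)
    pair-extend (pair-var k k ℕ.≤-refl) (((tt , context-within k) , (tt , tt) , tt) , tt)

pair-n : ∀ {K} k A → Within K (n A) → Derivable K (pair k A) → Derivable K (pair k (n A))
pair-n k A w minor =
  detach (fromClosed pair-negation) minor
    (detach-match σ₁ var (sym ([]-id (pair k A))) general refl)
    ((context-within k , (w , w) , tt) , tt)
  where
  σ₁ : Subst
  σ₁ 0 = context k
  σ₁ 1 = A
  σ₁ 2 = A
  σ₁ _ = var (suc k)
  major : Formula
  major = i (i (i x₀ (i (i x₁ x₂) x₃)) x₄) (i (i x₀ (i (i (n x₂) (n x₁)) x₃)) x₄)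
  general : MostGeneral (i (i x₀ (i (i x₁ x₂) x₃)) x₄) (i (i x₀ (i (i (n x₂) (n x₁)) x₃)) x₄)
              (pair k A) σ₁ var
  general τ₁ τ₂ eq with pair-injective eq
  ... | eq₀ , eq₁₂ , eq₃ , eq₄ with i-injective eq₁₂
  ... | eq₁ , eq₂ = τ₂ ,
      []-factor major τ₁ σ₁ τ₂ (below-bound major) (eq₀ ∷ eq₁ ∷ eq₂ ∷ eq₃ ∷ eq₄ ∷ [])
    , cong (_[ τ₂ ]) (sym ([]-id (pair k A)))

pair-i : ∀ {K} k A B → Below (suc k) A → Below (suc k) B → Within K A → Within K B →
  Derivable K (pair k A) → Derivable K (pair k B) → Derivable K (pair k (i A B))
pair-i {K} k A B A<m B<m wA wB first second =
  detach partial first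
    (detach-match σ₂ var (sym (trans ([]-id (pair k A)) antecedent-σ₂)) general₂ consequent-σ₂)
    ((context-within k , ((wA , wB) , wA , wB) , tt) , tt)
  where
  m : ℕ
  m = 2 + k
  z p q r antecedent consequent : Formula
  z = var (suc k)
  p = var (5 + m)
  q = var (6 + m)
  r = var (7 + m)
  antecedent = i (i (context k) (i (i p q) z)) r
  consequent = i (i (context k) (i (i (i q B) (i p B)) z)) r

  σ₁ : Subst
  σ₁ 0 = context k
  σ₁ 1 = B
  σ₁ 2 = B
  σ₁ 3 = z
  σ₁ 4 = z
  -- `x₅`, `x₆`, `x₇` do not occur in `A₁` and stay free as `p`, `q`, `r`, beyond the variables of
  -- `pair k B`.
  σ₁ x = var (x + m)

  A₁ D₁ : Formula
  A₁ = i (i x₀ (i (i x₁ x₂) x₃)) x₄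
  D₁ = i (i (i x₀ (i (i x₅ x₆) x₄)) x₇) (i (i x₀ (i (i (i x₆ x₁) (i x₅ x₂)) x₃)) x₇)

  z-below : Below m z
  z-below .(suc k) here = ℕ.≤-refl

  general₁ : MostGeneral A₁ D₁ (pair k B) σ₁ var
  general₁ τ₁ τ₂ eq with pair-injective eq
  ... | eq₀ , eq₁₂ , eq₃ , eq₄ with i-injective eq₁₂
  ... | eq₁ , eq₂ = ρ ,
      []-factor (i A₁ D₁) τ₁ σ₁ ρ (below-bound (i A₁ D₁))
        (trans eq₀ (sym ctx-ρ) ∷ trans eq₁ (sym B-ρ) ∷ trans eq₂ (sym B-ρ) ∷
         trans eq₃ (sym z-ρ) ∷ trans eq₄ (sym z-ρ) ∷
         sym (join-+ m 5) ∷ sym (join-+ m 6) ∷ sym (join-+ m 7) ∷ [])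
    , sym (trans (cong (_[ ρ ]) ([]-id (pair k B)))
        (cong₂ i (cong₂ i ctx-ρ (cong₂ i (cong₂ i B-ρ B-ρ) z-ρ)) z-ρ))
    where
    ρ : Subst
    ρ = join m τ₂ τ₁
    ctx-ρ : context k [ ρ ] ≡ context k [ τ₂ ]
    ctx-ρ = []-join (context k) (below-weaken (context-below k))
    B-ρ : B [ ρ ] ≡ B [ τ₂ ]
    B-ρ = []-join B (below-weaken B<m)
    z-ρ : ρ (suc k) ≡ τ₂ (suc k)
    z-ρ = []-join z z-below

  partial : Derivable K (i antecedent consequent)
  partial = detach (fromClosed pair-implication) second
    (detach-match σ₁ var (sym ([]-id (pair k B))) general₁ refl)
    (((context-within k , (tt , tt) , tt) , tt) ,
     ((context-within k , ((tt , wB) , tt , wB) , tt) , tt))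

  π σ₂ : Subst
  π 5 = A
  π 6 = A
  π _ = z
  σ₂ = join m var π

  fixed : ∀ F → Below m F → F ≡ F [ σ₂ ]
  fixed F F<m = sym (trans ([]-join F F<m) ([]-id F))

  antecedent-σ₂ : pair k A ≡ antecedent [ σ₂ ]
  antecedent-σ₂ = cong₂ i
    (cong₂ i (fixed (context k) (below-weaken (context-below k)))
      (cong₂ i (cong₂ i (sym (join-+ m 5)) (sym (join-+ m 6))) (fixed z z-below)))
    (sym (join-+ m 7))

  consequent-σ₂ : pair k (i A B) ≡ consequent [ σ₂ ]
  consequent-σ₂ = cong₂ i
    (cong₂ i (fixed (context k) (below-weaken (context-below k)))
      (cong₂ i
        (cong₂ i (cong₂ i (sym (join-+ m 6)) (fixed B (below-weaken B<m)))
                 (cong₂ i (sym (join-+ m 5)) (fixed B (below-weaken B<m))))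
        (fixed z z-below)))
    (sym (join-+ m 7))

  general₂ : MostGeneral antecedent consequent (pair k A) σ₂ var
  general₂ τ₁ τ₂ eq with pair-injective eq
  ... | eq-ctx , eq-pq , eq-z , eq-r with i-injective eq-pq
  ... | eq-p , eq-q = τ₂ ,
      cong₂ i
        (trans eq (cong (_[ τ₂ ]) antecedent-σ₂))
        (trans (cong₂ i (cong₂ i eq-ctx (cong₂ i (cong₂ i (cong₂ i eq-q eq-B) (cong₂ i eq-p eq-B)) eq-z)) eq-r)
               (cong (_[ τ₂ ]) consequent-σ₂))
    , cong (_[ τ₂ ]) (sym ([]-id (pair k A)))
    where
    -- The contexts agree under `τ₁` and `τ₂` and contain every variable of `B`, so the two
    -- instances of `B` agree as well.
    eq-B : B [ τ₁ ] ≡ B [ τ₂ ]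
    eq-B = []-cong B λ x o → []-agree (context k) eq-ctx x (occurs-context (B<m x o))

pair-derivable : ∀ {K} k A → Below (suc k) A → Within K A → Derivable K (pair k A)
pair-derivable k (var x) A<m w = pair-var k x (ℕ.≤-pred (A<m x here))
pair-derivable k (i A B) A<m (v , w) =
  pair-i k A B (λ x p → A<m x (left p)) (λ x p → A<m x (right p)) v w
    (pair-derivable k A (λ x p → A<m x (left p)) v)
    (pair-derivable k B (λ x p → A<m x (right p)) w)
pair-derivable k (n A) A<m w =
  pair-n k A w (pair-derivable k A (λ x p → A<m x (under p)) (within-n A w))

identity-instance : ∀ {K} A → Within K A → Derivable K (i A A)
identity-instance A w =
  detach (fromClosed pair-second) (pair-derivable k A A<m w)
    (detach-match σ₁ σ₂ (sym minor-σ₂) general refl) (w , w)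
  where
  k m : ℕ
  k = bound A
  m = suc k
  A<m : Below m A
  A<m = below-weaken (below-bound A)
  σ₁ σ₂ : Subst
  σ₁ 0 = context k
  σ₁ _ = i A A
  σ₂ = join m var (λ _ → i A A)
  minor-σ₂ : pair k A [ σ₂ ] ≡ i (i (context k) (i (i A A) (i A A))) (i A A)
  minor-σ₂
    rewrite []-join {m} {var} {λ _ → i A A} (context k) (context-below k)
          | []-join {m} {var} {λ _ → i A A} A A<m
          | join-+ m {var} {λ _ → i A A} 0
          | []-id (context k) | []-id A = refl
  major : Formula
  major = i (i (i x₀ (i x₁ x₁)) x₂) x₂
  general : MostGeneral (i (i x₀ (i x₁ x₁)) x₂) x₂ (pair k A) σ₁ σ₂
  general τ₁ τ₂ eq with pair-injective eq
  ... | eq₀ , eq₁ , eq₁′ , eq₂ = τ₂ ,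
      []-factor major τ₁ σ₁ τ₂ (below-bound major) (eq₀ ∷ eq₁ ∷ trans eq₂ eq-z ∷ [])
    , trans (cong₂ i (cong (λ Z → i (context k [ τ₂ ]) (i (i A A [ τ₂ ]) Z)) eq-z) eq-z)
            (cong (_[ τ₂ ]) (sym minor-σ₂))
    where
    eq-z : τ₂ m ≡ i A A [ τ₂ ]
    eq-z = trans (sym eq₁′) eq₁

-- Substitution instances and modus ponens by condensed detachment

instance-derivable : ∀ {K α} θ → Closed α → Within K (α [ θ ]) → Derivable K (α [ θ ])
instance-derivable {α = α} θ d w =
  detach (identity-instance (α [ θ ]) w) (fromClosed d)
    (detach-match var θ ([]-id (α [ θ ])) general (sym ([]-id (α [ θ ])))) w
  where
  general : MostGeneral (α [ θ ]) (α [ θ ]) α var θ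
  general τ₁ τ₂ eq = τ₁ , cong (_[ τ₁ ]) (sym ([]-id (i (α [ θ ]) (α [ θ ])))) , sym eq

-- Unifying `A` with a renamed copy of itself instantiates nothing, so the conclusion is `B` itself.
modus-ponens : ∀ {K A B} → Within K B → Derivable K (i A B) → Derivable K A → Derivable K B
modus-ponens {A = A} {B} w p q =
  detach p q (detach-match var var refl general (sym ([]-id B))) w
  where
  general : MostGeneral A B A var var
  general τ₁ τ₂ eq = τ₁ , cong (_[ τ₁ ]) (sym ([]-id (i A B))) ,
    trans (sym eq) (cong (_[ τ₁ ]) (sym ([]-id A)))

-- Substitution and modus ponens

data Theorem : Formula → Set where
  instantiate : ∀ {α} → α ∈ InfiniteValued → ∀ θ → Theorem (α [ θ ])
  mp          : ∀ {A B} → Theorem (i A B) → Theorem A → Theorem B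

Theorem-[] : ∀ {A} θ → Theorem A → Theorem (A [ θ ])
Theorem-[] θ (instantiate {α} α∈L σ) =
  subst Theorem (sym ([]-comp α)) (instantiate α∈L (λ x → σ x [ θ ]))
Theorem-[] θ (mp p q) = mp (Theorem-[] θ p) (Theorem-[] θ q)

Theorem-variant : ∀ {A B} → Variant A B → Theorem A → Theorem B
Theorem-variant (ρ , _ , refl) = Theorem-[] (λ x → var (ρ x))

Theorem-axiom : ∀ {A} → IsAxiom InfiniteValued A → Theorem A
Theorem-axiom (α , α∈L , variant) =
  Theorem-variant variant (subst Theorem ([]-id α) (instantiate α∈L var))

Theorem-detach : ∀ {P M A} → CondensedDetachment P M A → Theorem P → Theorem M → Theorem A
Theorem-detach cd p q = Theorem-variant conclusion-variant
  (mp (Theorem-[] σ (Theorem-variant major-variant p))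
      (subst Theorem (sym (proj₁ mgu)) (Theorem-[] σ (Theorem-variant minor-variant q))))
  where open CondensedDetachment cd

proof-sound : ∀ {Π} → IsProof InfiniteValued Π → All Theorem Π
proof-sound []                    = []
proof-sound (axiom a Π)           = Theorem-axiom a ∷ proof-sound Π
proof-sound (detach p∈ m∈ cd Π)   =
  Theorem-detach cd (All.lookup (proof-sound Π) p∈) (All.lookup (proof-sound Π) m∈) ∷ proof-sound Π

derivable-sound : ∀ {K A} → Derivable K A → Theorem A
derivable-sound (axiom a)         = Theorem-axiom a
derivable-sound (detach p q cd _) = Theorem-detach cd (derivable-sound p) (derivable-sound q)

-- Erasure

-- A predicate instead of a list, because the second erasure selects infinitely many double
-- negations.
eraseBy : (Formula → Bool) → Formula → Formula
eraseBy e (var x)     = var x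
eraseBy e (i A B)     = i (eraseBy e A) (eraseBy e B)
eraseBy e (n (n q))   = if e (n (n q)) then eraseBy e q else n (eraseBy e (n q))
eraseBy e (n (var x)) = n (var x)
eraseBy e (n (i A B)) = n (i (eraseBy e A) (eraseBy e B))

erase≡eraseBy : ∀ S A → erase S A ≡ eraseBy (λ s → does (s ∈? S)) A
erase≡eraseBy S (var x)     = refl
erase≡eraseBy S (i A B)     = cong₂ i (erase≡eraseBy S A) (erase≡eraseBy S B)
erase≡eraseBy S (n (n q))   =
  cong₂ (if does (n (n q) ∈? S) then_else_) (erase≡eraseBy S q) (cong n (erase≡eraseBy S (n q)))
erase≡eraseBy S (n (var x)) = refl
erase≡eraseBy S (n (i A B)) = cong n (cong₂ i (erase≡eraseBy S A) (erase≡eraseBy S B))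

module _ (e : Formula → Bool) where

  -- If `n (n A)` is selected, it erases to the same formula as `A`, so the two alternatives for `A`
  -- change places.
  eraseBy-n : ∀ A → eraseBy e (n A) ≡ n (eraseBy e A) ⊎ eraseBy e A ≡ n (eraseBy e (n A))
  eraseBy-n (var x) = inj₁ refl
  eraseBy-n (i A B) = inj₁ refl
  eraseBy-n (n A) with e (n (n A)) | eraseBy-n A
  ... | false | _       = inj₁ refl
  ... | true  | inj₁ eq = inj₂ eq
  ... | true  | inj₂ eq = inj₁ eq

  -- An erased instance of A4 is an instance of A4 or of one of the three
  -- contraposition laws, according to which alternative of eraseBy-n holds.
  erase-theorem : (Q : Formula → Set) →
    (∀ {α} θ A → Closed α → α [ θ ] ≡ eraseBy e A → Q (α [ θ ])) →
    (∀ A B → Q (eraseBy e (i A B)) → Q (eraseBy e A) → Q (eraseBy e B)) →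
    ∀ {A} → Theorem A → Q (eraseBy e A)
  erase-theorem Q inst mpQ = go
    where
    θ₂ : Formula → Formula → Subst
    θ₂ A B 0 = A
    θ₂ A B _ = B
    by : ∀ {α} θ A → Closed α → α [ θ ] ≡ eraseBy e A → Q (eraseBy e A)
    by θ A d eq = subst Q eq (inst θ A d eq)
    go : ∀ {A} → Theorem A → Q (eraseBy e A)
    go (mp {A} {B} p q) = mpQ A B (go p) (go q)
    go (instantiate (here refl) θ) = by (eraseBy e ∘ θ) (A1 [ θ ]) a1 refl
    go (instantiate (there (here refl)) θ) = by (eraseBy e ∘ θ) (A2 [ θ ]) a2 refl
    go (instantiate (there (there (here refl))) θ) = by (eraseBy e ∘ θ) (A3 [ θ ]) a3 refl
    go (instantiate (there (there (there (here refl)))) θ)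
      with eraseBy-n (θ 0) | eraseBy-n (θ 1)
    ... | inj₁ eq₀ | inj₁ eq₁ = by (eraseBy e ∘ θ) (A4 [ θ ]) a4
          (cong₂ (λ u v → i (i u v) (i (eraseBy e (θ 1)) (eraseBy e (θ 0)))) (sym eq₀) (sym eq₁))
    ... | inj₁ eq₀ | inj₂ eq₁ =
          by (θ₂ (eraseBy e (θ 0)) (eraseBy e (n (θ 1)))) (A4 [ θ ]) contraposition-n-left
          (cong₂ (λ u v → i (i u (eraseBy e (n (θ 1)))) (i v (eraseBy e (θ 0)))) (sym eq₀) (sym eq₁))
    ... | inj₂ eq₀ | inj₁ eq₁ =
          by (θ₂ (eraseBy e (n (θ 0))) (eraseBy e (θ 1))) (A4 [ θ ]) contraposition-n-right
          (cong₂ (λ u v → i (i (eraseBy e (n (θ 0))) v) (i (eraseBy e (θ 1)) u)) (sym eq₀) (sym eq₁))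
    ... | inj₂ eq₀ | inj₂ eq₁ =
          by (θ₂ (eraseBy e (n (θ 0))) (eraseBy e (n (θ 1)))) (A4 [ θ ]) contraposition
          (cong₂ (λ u v → i (i (eraseBy e (n (θ 0))) (eraseBy e (n (θ 1)))) (i v u)) (sym eq₀) (sym eq₁))

  eraseBy-theorem : ∀ {A} → Theorem A → Theorem (eraseBy e A)
  eraseBy-theorem = erase-theorem Theorem
    (λ θ _ d _ → Theorem-[] θ (derivable-sound d)) (λ _ _ → mp)

-- Erasing the double negations that do not occur in `G`

module _ (G : Formula) where

  Inside : Formula → Set
  Inside t = n (n t) ⊑ G

  foreign : Formula → Bool
  foreign s = not (does (s ⊑? G))

  inside-within : ∀ A → A ⊑ G → Within Inside A
  inside-within (var x)     p = tt
  inside-within (i A B)     p =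
    inside-within A (⊑-trans (left here) p) , inside-within B (⊑-trans (right here) p)
  inside-within (n (var x)) p = tt
  inside-within (n (i A B)) p = inside-within (i A B) (⊑-trans (under here) p)
  inside-within (n (n A))   p = p , inside-within (n A) (⊑-trans (under here) p)

  foreign-fixed : ∀ A → A ⊑ G → eraseBy foreign A ≡ A
  foreign-fixed (var x)     p = refl
  foreign-fixed (i A B)     p =
    cong₂ i (foreign-fixed A (⊑-trans (left here) p)) (foreign-fixed B (⊑-trans (right here) p))
  foreign-fixed (n (var x)) p = refl
  foreign-fixed (n (i A B)) p = cong n (foreign-fixed (i A B) (⊑-trans (under here) p))
  foreign-fixed (n (n A))   p with n (n A) ⊑? G | foreign-fixed (n A) (⊑-trans (under here) p)
  ... | yes _ | eq = cong n eq
  ... | no ¬p | _  = ⊥-elim (¬p p)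

  -- Erasing inside a double negation might create a new one, but a double negation that is kept
  -- occurs in `G`, and then nothing inside it is erased.
  foreign-within : ∀ A → Within Inside (eraseBy foreign A)
  foreign-within (var x)     = tt
  foreign-within (i A B)     = foreign-within A , foreign-within B
  foreign-within (n (var x)) = tt
  foreign-within (n (i A B)) = foreign-within A , foreign-within B
  foreign-within (n (n A)) with n (n A) ⊑? G | foreign-within A
  ... | no _  | w = w
  ... | yes p | _ = subst (Within Inside ∘ n) (sym (foreign-fixed (n A) (⊑-trans (under here) p)))
                  (inside-within (n (n A)) p)

  -- The erasure leaves `G` itself fixed, so the erased proof still ends in `G`.
  theorem-derivable : Theorem G → Derivable Inside G
  theorem-derivable thm = subst (Derivable Inside) (foreign-fixed G here)
    (erase-theorem foreign (Derivable Inside)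
      (λ θ A d eq → instance-derivable θ d (subst (Within Inside) (sym eq) (foreign-within A)))
      (λ A B → modus-ponens (foreign-within B)) thm)

-- From derivations to linear proofs

IsProof-++ : ∀ {L Γ Δ} → IsProof L Γ → IsProof L Δ → IsProof L (Γ ++ Δ)
IsProof-++ []                  Δ = Δ
IsProof-++ (axiom a Γ)         Δ = axiom a (IsProof-++ Γ Δ)
IsProof-++ (detach p∈ m∈ cd Γ) Δ = detach (∈-++⁺ˡ p∈) (∈-++⁺ˡ m∈) cd (IsProof-++ Γ Δ)

linearise : ∀ {K A} → Derivable K A →
  ∃[ Γ ] (IsProof InfiniteValued (A ∷ Γ) ×
          All (λ B → IsAxiom InfiniteValued B ⊎ Within K B) (A ∷ Γ))
linearise (axiom a) = [] , axiom a [] , inj₁ a ∷ []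
linearise (detach {P} {M} p q cd w) =
  let Γ , Γ-proof , Γ-within = linearise p
      Δ , Δ-proof , Δ-within = linearise q
  in P ∷ Γ ++ M ∷ Δ
   , detach (here refl) (∈-++⁺ʳ (P ∷ Γ) (here refl)) cd (IsProof-++ Γ-proof Δ-proof)
   , inj₂ w ∷ All.++⁺ Γ-within Δ-within

-- The first erasure shows that `B*` is a theorem, the second bounds its double negations. These
-- occur in `B*` literally, so the renaming is the identity.
theorem6 : AdmitsStrongDNE InfiniteValued
theorem6 B B* (_ , B-proof , _ , refl) (S , _ , B*≡erase) =
  let B*-theorem = subst Theorem (sym (trans B*≡erase (erase≡eraseBy S B)))
                     (eraseBy-theorem _ (All.head (proof-sound B-proof)))
      Γ , Γ-proof , Γ-within = linearise (theorem-derivable B* B*-theorem)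
  in B* ∷ Γ , (Γ-proof , Γ , refl) , λ A (A∈Π , ¬axiom) t p →
     case All.lookup Γ-within A∈Π of λ
       { (inj₁ axiom-A)  → ⊥-elim (¬axiom axiom-A)
       ; (inj₂ within-A) → n (n t) , within-⊑ A within-A p , Variant-refl
       }
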